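{- For every integer $t\geq 3$ and every finite simple graph $G$ (with at least one vertex) that has no $K_t$ minor, $\chi_{pcf}(G)\leq 5(t-1)(t-2)-1$.
   Context: A $c$-colouring of $G$ is a function $\psi:V(G)\to C$ with $|C|\leq c$; it is proper if adjacent vertices get different colours, and conflict-free if for every vertex $v$ with nonempty neighbourhood $N(v)$ there is a colour $\alpha$ with $|\{w\in N(v):\psi(w)=\alpha\}|=1$. $\chi_{pcf}(G)$ is the minimum $c$ such that $G$ has a proper conflict-free $c$-colouring. -}

module Defs where

open import Data.Nat using (ℕ)
open import Data.Fin using (Fin)
open import Data.Bool using (Bool; true; false)
open import Data.Maybe using (Maybe; just)
open import Data.Product using (Σ; ∃; ∃-syntax; _×_)
open import Relation.Binary.PropositionalEquality using (_≡_; _≢_)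

record Graph (n : ℕ) : Set where
  field
    adj   : Fin n → Fin n → Bool
    sym   : ∀ u v → adj u v ≡ adj v u
    irrfl : ∀ v → adj v v ≡ false
open Graph public

Adj : ∀ {n} → Graph n → Fin n → Fin n → Set
Adj G u v = adj G u v ≡ true

data WalkIn {n : ℕ} (G : Graph n) (P : Fin n → Set) : Fin n → Fin n → Set where
  here : ∀ {u} → P u → WalkIn G P u u
  step : ∀ {u w v} → P u → Adj G u w → WalkIn G P w v → WalkIn G P u v

-- G has a K_t minor: there are t pairwise disjoint, nonempty, connected
-- branch sets, every two of which are joined by an edge.  The branch sets
-- are encoded by a map β : V(G) → Maybe (Fin t); branch set i is
-- {v | β v ≡ just i} (so disjointness is automatic).
HasKMinor : ∀ {n} → Graph n → ℕ → Set
HasKMinor {n} G t =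
  Σ (Fin n → Maybe (Fin t)) λ β →
    (∀ i → ∃[ v ] β v ≡ just i)
  × (∀ i u v → β u ≡ just i → β v ≡ just i →
       WalkIn G (λ x → β x ≡ just i) u v)
  × (∀ i j → i ≢ j → ∃[ u ] ∃[ v ] (β u ≡ just i × β v ≡ just j × Adj G u v))

Proper : ∀ {n c} → Graph n → (Fin n → Fin c) → Set
Proper G ψ = ∀ u v → Adj G u v → ψ u ≢ ψ v

ConflictFree : ∀ {n c} → Graph n → (Fin n → Fin c) → Set
ConflictFree {n} {c} G ψ =
  ∀ v → (∃[ w ] Adj G v w) →
    ∃[ α ] ∃[ w ] (Adj G v w × ψ w ≡ α ×
      (∀ w' → Adj G v w' → ψ w' ≡ α → w' ≡ w))

χpcf≤ : ∀ {n} → Graph n → ℕ → Set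
χpcf≤ {n} G c = Σ (Fin n → Fin c) λ ψ → Proper G ψ × ConflictFree G ψ

{-# OPTIONS --safe #-}

-- Vertices are removed in connected bags.  If C is a component of what remains,
-- the earlier bags with a neighbour in C are pairwise adjacent, so together with
-- C they form a clique minor and there are at most t − 2 of them.  The next bag
-- is a union of at most t − 2 root paths of a BFS tree of C, reaching a neighbour
-- of each of these bags.  Colour greedily bag by bag, and by BFS depth within a
-- bag.  The colour to be unique around w is that of π w, the BFS parent of w, or
-- for a BFS root its first neighbour.  Hence v has to avoid the colours of
--   * the earlier vertices u with v – u or v – x – u, where x is later than v;
--   * the vertices π w, for the earlier neighbours w of v.
-- On one path of an earlier bag all of these lie on the five levels within 2 of
-- the level of v, or are π of the root; on a path of its own bag, on three
-- levels.  With k = t − 2 this forbids at most 5k² + 3k < 5k(k + 1) − 1 colours.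
module Submission where

open import Defs
open import Data.Bool using (true; if_then_else_)
open import Data.Bool.Properties using () renaming (_≟_ to _≟ᵇ_)
open import Data.Fin using (Fin; zero; suc; toℕ; inject≤) renaming (_<_ to _<ᶠ_)
open import Data.Fin.Properties using (any?; pigeonhole; <⇒≢; inject≤-injective; toℕ<n; toℕ-injective) renaming (_≟_ to _≟ᶠ_; <-cmp to <-cmpᶠ)
open import Data.Fin.Subset using (Subset; _∈_; _∉_; _⊆_; _⊂_; _⊃_; _∪_; ⁅_⁆; ⊤; Empty)
open import Data.Fin.Subset.Induction using (⊂-wellFounded; ⊃-wellFounded; Acc; acc)
open import Data.Fin.Subset.Properties using (_∈?_; nonempty?; ∈⊤; p⊆p∪q; q⊆p∪q; x∈p∪q⁻; x∈⁅x⁆; x∈⁅y⁆⇒x≡y)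
open import Data.List using (List; []; _∷_; _++_; length; map; lookup; filter; concatMap; applyUpTo)
open import Data.List.Properties using (length-map; length-++; length-applyUpTo)
open import Data.List.Membership.Propositional using (find; lose) renaming (_∈_ to _∈ₗ_; _∉_ to _∉ₗ_)
open import Data.List.Membership.Propositional.Properties using (∈-map⁺; ∈-map⁻; ∈-filter⁺; ∈-filter⁻; ∈-concatMap⁺; ∈-++⁺ˡ; ∈-++⁺ʳ; ∈-applyUpTo⁺; ∈-lookup)
open import Data.List.Relation.Unary.All as All using (All; []; _∷_)
open import Data.List.Relation.Unary.AllPairs as AllPairs using (AllPairs; []; _∷_)
open import Data.List.Relation.Unary.Any as Any using (Any; here; there; index)
open import Data.List.Relation.Unary.Any.Properties using (lookup-index)
open import Data.Maybe using (Maybe; just; nothing)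
open import Data.Nat using (ℕ; zero; suc; _+_; _*_; _∸_; _⊔_; _≤_; _<_; z≤n; s≤s; s≤s⁻¹)
open import Data.Nat.Induction using (<-wellFounded)
open import Data.Nat.Properties using (≤-refl; ≤-trans; ≤-reflexive; ≤-antisym; ≤-total; <-≤-trans; n≤1+n; <-irrefl; m≤n⇒m<n∨m≡n; ≮⇒≥; <⇒≤; <⇒≱; <-cmp; suc-injective; m≤m⊔n; m≤n⊔m; m≤m+n; m≤n+m; +-mono-≤; +-monoˡ-≤; +-monoʳ-<; *-monoˡ-≤; +-comm; +-suc; +-cancelˡ-<; +-cancelˡ-≤; +-cancelˡ-≡; +-∸-assoc; m+[n∸m]≡n; m≤n+o⇒m∸n≤o; m≤n+m∸n; n∸n≡0; _≤?_; _<?_; _≟_; module ≤-Reasoning)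
open import Data.Nat.Solver using (module +-*-Solver)
open import Data.Product using (∃; ∃-syntax; _×_; _,_; proj₁; proj₂)
open import Data.Sum as Sum using (_⊎_; inj₁; inj₂)
open import Data.Unit using (tt) renaming (⊤ to Unit)
open import Data.Vec using (tabulate)
open import Data.Vec.Properties using (lookup∘tabulate; []=⇒lookup; lookup⇒[]=)
open import Function using (_∘_)
open import Relation.Binary.Definitions using (tri<; tri≈; tri>)
open import Relation.Binary.PropositionalEquality using (_≡_; _≢_; refl; trans; cong; subst) renaming (sym to ≡-sym)
open import Relation.Nullary using (¬_; Dec; yes; no; does; contradiction)
open import Relation.Nullary.Decidable using (_×-dec_; dec-true; ¬?; decidable-stable)
open import Relation.Unary using (Decidable)
import Data.List.Membership.DecPropositional as DecMembership
import Data.List.Relation.Unary.AllPairs.Properties as AllPairs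
open +-*-Solver using (solve; con; _:+_; _:*_; _:=_)

-- Decidable subsets, piecewise functions and greedy colouring.

comprehension : ∀ {n} {P : Fin n → Set} → Decidable P → Subset n
comprehension P? = tabulate (does ∘ P?)

∈-comprehension⁺ : ∀ {n} {P : Fin n → Set} (P? : Decidable P) {v} → P v → v ∈ comprehension P?
∈-comprehension⁺ P? {v} pv = lookup⇒[]= v _ (trans (lookup∘tabulate _ v) (dec-true (P? v) pv))

∈-comprehension⁻ : ∀ {n} {P : Fin n → Set} (P? : Decidable P) {v} → v ∈ comprehension P? → P v
∈-comprehension⁻ P? {v} v∈ with P? v | trans (≡-sym (lookup∘tabulate (does ∘ P?) v)) ([]=⇒lookup v∈)
... | yes pv | _ = pv
... | no _ | ()

override : ∀ {n} {A : Set} → Subset n → (Fin n → A) → (Fin n → A) → Fin n → A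
override S f g v = if does (v ∈? S) then f v else g v

override-∈ : ∀ {n} {A : Set} {S : Subset n} (f g : Fin n → A) {v} → v ∈ S → override S f g v ≡ f v
override-∈ {S = S} f g {v} v∈S with v ∈? S
... | yes _ = refl
... | no v∉S = contradiction v∈S v∉S

override-∉ : ∀ {n} {A : Set} {S : Subset n} (f g : Fin n → A) {v} → v ∉ S → override S f g v ≡ g v
override-∉ {S = S} f g {v} v∉S with v ∈? S
... | yes v∈S = contradiction v∈S v∉S
... | no _ = refl

-- If every colour occurred, choosing a position of each would inject `Fin c` into fewer than `c`
-- positions.
missingColour : ∀ {c} (xs : List (Fin c)) → length xs < c → ∃ λ α → α ∉ₗ xs
missingColour {c} xs short with any? (λ α → ¬? (DecMembership._∈?_ _≟ᶠ_ α xs))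
... | yes found = found
... | no none = contradiction αᵢ≡αⱼ (<⇒≢ i<j)
  where
  all∈ : ∀ α → α ∈ₗ xs
  all∈ α = decidable-stable (DecMembership._∈?_ _≟ᶠ_ α xs) (λ α∉ → none (α , α∉))
  clash = pigeonhole short (index ∘ all∈)
  i = proj₁ clash
  j = proj₁ (proj₂ clash)
  i<j = proj₁ (proj₂ (proj₂ clash))
  αᵢ≡αⱼ : i ≡ j
  αᵢ≡αⱼ = trans (lookup-index (all∈ i))
    (trans (cong (lookup xs) (proj₂ (proj₂ (proj₂ clash)))) (≡-sym (lookup-index (all∈ j))))

bounded : ∀ {n} (f : Fin n → ℕ) → ∃ λ m → ∀ v → f v < m
bounded {zero} f = 0 , λ ()
bounded {suc n} f with bounded (f ∘ suc)
... | m , <m = suc (f zero) ⊔ m , λ { zero → m≤m⊔n (suc (f zero)) m ; (suc v) → ≤-trans (<m v) (m≤n⊔m (suc (f zero)) m) }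

-- Vertices of equal rank do not constrain each other, so each rank is coloured in one go.
greedyColouring : ∀ {n c} (rank : Fin n → ℕ) (F : Fin n → List (Fin n)) →
  (∀ v → length (F v) < suc c) →
  ∃ λ (ψ : Fin n → Fin (suc c)) → ∀ u v → u ∈ₗ F v → rank u < rank v → ψ u ≢ ψ v
greedyColouring {n} {c} rank F short = ψ , good
  where
  Good : ℕ → (Fin n → Fin (suc c)) → Set
  Good k ψ = ∀ u v → u ∈ₗ F v → rank u < rank v → rank v < k → ψ u ≢ ψ v

  upTo : ∀ k → ∃ (Good k)
  upTo zero = (λ _ → zero) , λ _ _ _ _ ()
  upTo (suc k) with upTo k
  ... | ψ , good = ψ′ , good′
    where
    free : ∀ v → ∃ λ α → α ∉ₗ map ψ (F v)
    free v = missingColour (map ψ (F v)) (subst (_< suc c) (≡-sym (length-map ψ (F v))) (short v))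
    atRank : Decidable (λ v → rank v ≡ k)
    atRank v = rank v ≟ k
    ψ′ : Fin n → Fin (suc c)
    ψ′ = override (comprehension atRank) (proj₁ ∘ free) ψ
    new : ∀ {v} → rank v ≡ k → ψ′ v ≡ proj₁ (free v)
    new eq = override-∈ (proj₁ ∘ free) ψ (∈-comprehension⁺ atRank eq)
    old : ∀ {v} → rank v < k → ψ′ v ≡ ψ v
    old lt = override-∉ (proj₁ ∘ free) ψ (λ v∈ → <-irrefl (∈-comprehension⁻ atRank v∈) lt)
    good′ : Good (suc k) ψ′
    good′ u v u∈ u<v (s≤s v≤k) ψu≡ψv with m≤n⇒m<n∨m≡n v≤k
    ... | inj₁ v<k = good u v u∈ u<v v<k (trans (≡-sym (old (≤-trans u<v v≤k))) (trans ψu≡ψv (old v<k)))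
    ... | inj₂ v≡k = proj₂ (free v) (subst (_∈ₗ map ψ (F v))
            (trans (≡-sym (old (≤-trans u<v v≤k))) (trans ψu≡ψv (new v≡k))) (∈-map⁺ ψ u∈))

  ψ = proj₁ (upTo (proj₁ (bounded rank)))
  good = λ u v u∈ u<v → proj₂ (upTo (proj₁ (bounded rank))) u v u∈ u<v (proj₂ (bounded rank) v)

-- Walks, connected sets and clique minors.

Adj-sym : ∀ {n} (G : Graph n) {u v} → Adj G u v → Adj G v u
Adj-sym G {u} {v} = trans (Graph.sym G v u)

adj? : ∀ {n} (G : Graph n) u v → Dec (Adj G u v)
adj? G u v = adj G u v ≟ᵇ true

module _ {n : ℕ} {G : Graph n} where

  walk-map : ∀ {P Q : Fin n → Set} → (∀ {x} → P x → Q x) → ∀ {u v} → WalkIn G P u v → WalkIn G Q u v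
  walk-map f (here p) = here (f p)
  walk-map f (step p e w) = step (f p) e (walk-map f w)

  walk-start : ∀ {P : Fin n → Set} {u v} → WalkIn G P u v → P u
  walk-start (here p) = p
  walk-start (step p _ _) = p

  walk-++ : ∀ {P : Fin n → Set} {u v w} → WalkIn G P u v → WalkIn G P v w → WalkIn G P u w
  walk-++ (here _) w = w
  walk-++ (step p e w) w′ = step p e (walk-++ w w′)

  walk-reverse : ∀ {P : Fin n → Set} {u v} → WalkIn G P u v → WalkIn G P v u
  walk-reverse (here p) = here p
  walk-reverse (step p e w) = walk-++ (walk-reverse w) (step (walk-start w) (Adj-sym G e) (here p))

Joined : ∀ {n} → Graph n → Subset n → Subset n → Set
Joined G A B = ∃[ a ] ∃[ b ] (a ∈ A × b ∈ B × Adj G a b)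

Connected : ∀ {n} → Graph n → Subset n → Set
Connected G A = ∀ u v → u ∈ A → v ∈ A → WalkIn G (_∈ A) u v

-- By disjointness the index found for a vertex is its only one, so the family `B` becomes the
-- partial map of `HasKMinor`.
disjointModel : ∀ {n t} (G : Graph n) (B : Fin t → Subset n) →
  (∀ i → ∃ (_∈ B i)) → (∀ i → Connected G (B i)) →
  (∀ {i j v} → v ∈ B i → v ∈ B j → i ≡ j) →
  (∀ i j → i ≢ j → Joined G (B i) (B j)) → HasKMinor G t
disjointModel {n} {t} G B nonempty connected disjoint joined =
  β , (λ i → let v , v∈ = nonempty i in v , β⁺ v∈)
    , (λ i u v u∈ v∈ → walk-map β⁺ (connected i u v (β⁻ u∈) (β⁻ v∈)))
    , (λ i j i≢j → let a , b , a∈ , b∈ , e = joined i j i≢j in a , b , β⁺ a∈ , β⁺ b∈ , e)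
  where
  β : Fin n → Maybe (Fin t)
  β v with any? (λ i → v ∈? B i)
  ... | yes (i , _) = just i
  ... | no _ = nothing
  β⁺ : ∀ {i v} → v ∈ B i → β v ≡ just i
  β⁺ {i} {v} v∈ with any? (λ i → v ∈? B i)
  ... | yes (j , v∈j) = cong just (disjoint v∈j v∈)
  ... | no none = contradiction (i , v∈) none
  β⁻ : ∀ {i v} → β v ≡ just i → v ∈ B i
  β⁻ {i} {v} eq with any? (λ i → v ∈? B i)
  β⁻ {i} {v} refl | yes (_ , v∈) = v∈
  β⁻ {i} {v} () | no _

-- Breadth-first search of one component.

record Layers {n} (G : Graph n) (U : Subset n) (r : Fin n) (Expanded : ℕ → Set) : Set where
  field
    C : Subset n
    d : Fin n → ℕ
    p : Fin n → Fin n
    C⊆U : C ⊆ U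
    r∈C : r ∈ C
    d-root : d r ≡ 0
    root-unique : ∀ {v} → v ∈ C → d v ≡ 0 → v ≡ r
    parent : ∀ {v j} → v ∈ C → d v ≡ suc j → p v ∈ C × Adj G (p v) v × d (p v) ≡ j
    lipschitz : ∀ {x y} → x ∈ C → y ∈ C → Adj G x y → d y ≤ suc (d x)
    closed : ∀ {x y} → x ∈ C → Expanded (d x) → y ∈ U → Adj G x y → y ∈ C
    -- Extends the Lipschitz bound to edges of `U` outside `C`, so that the invariant on bags need
    -- not mention components.
    constant-outside : ∀ {x y} → x ∉ C → y ∉ C → d x ≡ d y

-- `Expanded` holds for the depths whose neighbours in `U` all belong to `C`. When it always holds,
-- `C` is the whole component of `r` in `U`.
BFS : ∀ {n} (G : Graph n) (U : Subset n) (r : Fin n) → Set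
BFS G U r = Layers G U r (λ _ → Unit)

module _ {n : ℕ} (G : Graph n) (U : Subset n) (r : Fin n) where

  -- A round adds all outside neighbours of `C` at depth `suc k`. As `C` grows strictly in a finite
  -- set, the rounds end, and then `C` is closed.
  grow : ∀ k (L : Layers G U r (_< k)) → (∀ {v} → v ∈ Layers.C L → Layers.d L v ≤ k) →
         Acc _⊃_ (Layers.C L) → BFS G U r
  grow k L deep (acc rec) with any? (λ y → (y ∈? U) ×-dec (¬? (y ∈? Layers.C L)) ×-dec any? (λ x → (x ∈? Layers.C L) ×-dec adj? G x y))
  ... | no none = record { Layers L ; closed = closed′ }
    where
    open Layers L
    closed′ : ∀ {x y} → x ∈ C → Unit → y ∈ U → Adj G x y → y ∈ C
    closed′ {x} {y} x∈C _ y∈U e = decidable-stable (y ∈? C) (λ y∉C → none (y , y∈U , y∉C , x , x∈C , e))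
  ... | yes (z , z∈U , z∉C , zx) = grow (suc k) L′ deep′ (rec (p⊆p∪q New , z , q⊆p∪q C New (∈-comprehension⁺ new? (z∈U , z∉C , zx)) , z∉C))
    where
    open Layers L
    IsNew : Fin n → Set
    IsNew y = y ∈ U × y ∉ C × ∃[ x ] (x ∈ C × Adj G x y)
    new? : Decidable IsNew
    new? y = (y ∈? U) ×-dec (¬? (y ∈? C)) ×-dec any? (λ x → (x ∈? C) ×-dec adj? G x y)
    New = comprehension new?
    C′ = C ∪ New
    d′ = override C d (λ _ → suc k)
    back : Fin n → Fin n
    back y with any? (λ x → (x ∈? C) ×-dec adj? G x y)
    ... | yes (x , _) = x
    ... | no _ = y
    back-new : ∀ {y} → IsNew y → back y ∈ C × Adj G (back y) y
    back-new {y} (_ , _ , x , x∈) with any? (λ x → (x ∈? C) ×-dec adj? G x y)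
    ... | yes (_ , x∈′) = x∈′
    ... | no none = contradiction (x , x∈) none
    p′ = override C p back
    split : ∀ {v} → v ∈ C′ → v ∈ C ⊎ IsNew v
    split v∈ with x∈p∪q⁻ C New v∈
    ... | inj₁ v∈C = inj₁ v∈C
    ... | inj₂ v∈N = inj₂ (∈-comprehension⁻ new? v∈N)
    d-old : ∀ {v} → v ∈ C → d′ v ≡ d v
    d-old = override-∈ d _
    d-new : ∀ {v} → v ∉ C → d′ v ≡ suc k
    d-new = override-∉ d _
    -- Levels below `k` are expanded, so an edge leaving `C` starts at level `k`.
    atFrontier : ∀ {x y} → x ∈ C → y ∈ U → y ∉ C → Adj G x y → d x ≡ k
    atFrontier x∈C y∈U y∉C e with m≤n⇒m<n∨m≡n (deep x∈C)
    ... | inj₁ dx<k = contradiction (closed x∈C dx<k y∈U e) y∉C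
    ... | inj₂ dx≡k = dx≡k
    deep′ : ∀ {v} → v ∈ C′ → d′ v ≤ suc k
    deep′ v∈ with split v∈
    ... | inj₁ v∈C = ≤-trans (≤-reflexive (d-old v∈C)) (≤-trans (deep v∈C) (n≤1+n k))
    ... | inj₂ (_ , v∉C , _) = ≤-reflexive (d-new v∉C)
    root′ : ∀ {v} → v ∈ C′ → d′ v ≡ 0 → v ≡ r
    root′ v∈ d≡0 with split v∈
    ... | inj₁ v∈C = root-unique v∈C (trans (≡-sym (d-old v∈C)) d≡0)
    ... | inj₂ (_ , v∉C , _) = contradiction (trans (≡-sym (d-new v∉C)) d≡0) λ ()
    parent′ : ∀ {v j} → v ∈ C′ → d′ v ≡ suc j → p′ v ∈ C′ × Adj G (p′ v) v × d′ (p′ v) ≡ j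
    parent′ {v} v∈ d≡ with split v∈
    ... | inj₁ v∈C rewrite override-∈ p back v∈C =
      let pv∈ , e , dp = parent v∈C (trans (≡-sym (d-old v∈C)) d≡)
      in p⊆p∪q New pv∈ , e , trans (d-old pv∈) dp
    ... | inj₂ isNew@(v∈U , v∉C , _) rewrite override-∉ p back v∉C =
      let b∈ , e = back-new isNew
      in p⊆p∪q New b∈ , e , trans (d-old b∈) (trans (atFrontier b∈ v∈U v∉C e) (suc-injective (trans (≡-sym (d-new v∉C)) d≡)))
    lipschitz′ : ∀ {x y} → x ∈ C′ → y ∈ C′ → Adj G x y → d′ y ≤ suc (d′ x)
    lipschitz′ x∈ y∈ e with split x∈ | split y∈
    ... | inj₁ x∈C | inj₁ y∈C rewrite d-old x∈C | d-old y∈C = lipschitz x∈C y∈C e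
    ... | inj₁ x∈C | inj₂ (y∈U , y∉C , _) rewrite d-old x∈C | d-new y∉C | atFrontier x∈C y∈U y∉C e = ≤-refl
    ... | inj₂ (_ , x∉C , _) | _ rewrite d-new x∉C = ≤-trans (deep′ y∈) (n≤1+n (suc k))
    closed′ : ∀ {x y} → x ∈ C′ → d′ x < suc k → y ∈ U → Adj G x y → y ∈ C′
    closed′ {x} {y} x∈ lt y∈U e with split x∈ | y ∈? C
    ... | _ | yes y∈C = p⊆p∪q New y∈C
    ... | inj₁ x∈C | no y∉C = q⊆p∪q C New (∈-comprehension⁺ new? (y∈U , y∉C , x , x∈C , e))
    ... | inj₂ (_ , x∉C , _) | no _ = contradiction lt (<-irrefl (d-new x∉C))
    L′ : Layers G U r (_< suc k)
    L′ = record
      { C = C′ ; d = d′ ; p = p′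
      ; C⊆U = λ v∈ → C′⊆U v∈
      ; r∈C = p⊆p∪q New r∈C
      ; d-root = trans (d-old r∈C) d-root
      ; root-unique = root′ ; parent = parent′ ; lipschitz = lipschitz′ ; closed = closed′
      ; constant-outside = λ x∉ y∉ → trans (d-new (x∉ ∘ p⊆p∪q New)) (≡-sym (d-new (y∉ ∘ p⊆p∪q New))) }
      where
      C′⊆U : C′ ⊆ U
      C′⊆U v∈ with split v∈
      ... | inj₁ v∈C = C⊆U v∈C
      ... | inj₂ (v∈U , _) = v∈U

  bfs : r ∈ U → BFS G U r
  bfs r∈U = grow 0 L (λ _ → z≤n) (⊃-wellFounded ⁅ r ⁆)
    where
    onlyRoot : ∀ {v} → v ∈ ⁅ r ⁆ → v ≡ r
    onlyRoot = x∈⁅y⁆⇒x≡y r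
    L : Layers G U r (_< 0)
    L = record
      { C = ⁅ r ⁆ ; d = λ _ → 0 ; p = λ v → v
      ; C⊆U = λ v∈ → subst (_∈ U) (≡-sym (onlyRoot v∈)) r∈U
      ; r∈C = x∈⁅x⁆ r
      ; d-root = refl
      ; root-unique = λ v∈ _ → onlyRoot v∈
      ; parent = λ _ ()
      ; lipschitz = λ _ _ _ → z≤n
      ; closed = λ _ ()
      ; constant-outside = λ _ _ → refl }

-- Tracks and windows of levels.

iterate : ∀ {A : Set} → (A → A) → ℕ → A → A
iterate f zero x = x
iterate f (suc m) x = f (iterate f m x)

∸-unfold : ∀ {j m} → suc j ≤ m → m ∸ j ≡ suc (m ∸ suc j)
∸-unfold (s≤s j≤m) = +-∸-assoc 1 j≤m

lookupPair : ∀ {A : Set} {R : A → A → Set} {xs : List A} → AllPairs R xs →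
  ∀ {i j} → i <ᶠ j → R (lookup xs i) (lookup xs j)
lookupPair (Rx ∷ _) {zero} {suc j} _ = All.lookup Rx (∈-lookup j)
lookupPair (_ ∷ Rxs) {suc i} {suc j} i<j = lookupPair Rxs (s≤s⁻¹ i<j)

length-concatMap-≤ : ∀ {A B : Set} (f : A → List B) {m} (xs : List A) →
  (∀ {x} → x ∈ₗ xs → length (f x) ≤ m) → length (concatMap f xs) ≤ length xs * m
length-concatMap-≤ f [] _ = z≤n
length-concatMap-≤ f (x ∷ xs) short = ≤-trans (≤-reflexive (length-++ (f x)))
  (+-mono-≤ (short (here refl)) (length-concatMap-≤ f xs (short ∘ there)))

-- inj₁ u stands for the vertex u, inj₂ r for the first neighbour of the root r
-- in the final order, which is unknown when the bag of r is created.
Ref : ℕ → Set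
Ref n = Fin n ⊎ Fin n

-- A root path shifted by one: position suc j holds the vertex at level j and
-- position 0 the reference for the root, so that the parent of the vertex at
-- position suc j is always found at position j.
Track : ℕ → Set
Track n = ℕ → Ref n

-- Tracks are shifted by one, so position `D ∸ 1` means level `D - 2`: with `m = 5` the window
-- reaches level `D + 2`, with `m = 3` level `D`. Near the root it starts at position 0.
window : ∀ {n} → ℕ → ℕ → Track n → List (Ref n)
window m D e = applyUpTo (λ i → e ((D ∸ 1) + i)) m

-- The bounds avoid subtraction; for `D = 0` the truncated start leaves the window one entry longer
-- than they require.
∈-window : ∀ {n} m {D j} (e : Track n) → D ≤ suc j → suc (suc j) ≤ m + D → e j ∈ₗ window m D e
∈-window m {D} {j} e D≤ ≤D = subst (λ x → e x ∈ₗ window m D e) (m+[n∸m]≡n lower)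
  (∈-applyUpTo⁺ (λ i → e ((D ∸ 1) + i)) (+-cancelˡ-< (D ∸ 1) _ _ (<-≤-trans (≤-reflexive (cong suc (m+[n∸m]≡n lower))) upper)))
  where
  lower : D ∸ 1 ≤ j
  lower = m≤n+o⇒m∸n≤o D 1 D≤
  upper : suc j ≤ (D ∸ 1) + m
  upper = s≤s⁻¹ (≤-trans ≤D (≤-trans (≤-reflexive (+-comm m D)) (+-monoˡ-≤ m (m≤n+m∸n D 1))))

-- The invariant kept while bags are removed.

record Bag (n : ℕ) : Set where
  field
    mem : Subset n
    d : Fin n → ℕ
    tracks : List (Track n)
open Bag

record Info (n : ℕ) : Set where
  field
    key : ℕ
    parent : Ref n
    forbidden : List (Ref n)
open Info

-- `covered` puts a vertex and its parent reference on successive positions of one track, so windows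
-- catch both. `lipschitz` confines vertices at distance at most 2 to five levels.
record BagOK {n} (G : Graph n) (k : ℕ) (U : Subset n) (info : Fin n → Info n) (B : Bag n) : Set where
  field
    nonempty : ∃ (_∈ mem B)
    connected : Connected G (mem B)
    few : length (tracks B) ≤ k
    covered : ∀ {u} → u ∈ mem B → ∃ λ e → e ∈ₗ tracks B × e (suc (d B u)) ≡ inj₁ u × e (d B u) ≡ parent (info u)
    outside : ∀ {u} → u ∈ mem B → u ∉ U
    lipschitz : ∀ {x y} → x ∈ U → y ∈ U ⊎ y ∈ mem B → Adj G x y → d B x ≤ suc (d B y) × d B y ≤ suc (d B x)

-- The second half makes touching bags pairwise adjacent: a component touched by both supplies the
-- walk.
Linked : ∀ {n} → Graph n → Subset n → Bag n → Bag n → Set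
Linked G U A B = (∀ {v} → v ∈ mem A → v ∉ mem B) ×
  (∀ {a b x y} → a ∈ mem A → b ∈ mem B → Adj G a x → Adj G b y → WalkIn G (_∈ U) x y → Joined G (mem A) (mem B))

-- Inequalities between neighbourhood keys are weak because ties are broken only at the end. In
-- `near₂`, `x ∈ U` stands for a vertex not yet placed, whose final key will exceed that of `v`.
record Processed {n} (G : Graph n) (k : ℕ) (U : Subset n) (info : Fin n → Info n) (v : Fin n) : Set where
  field
    parentOK : parent (info v) ≡ inj₂ v ⊎
      ∃ λ p → parent (info v) ≡ inj₁ p × Adj G v p × p ∉ U × key (info p) < key (info v)
    short : length (forbidden (info v)) ≤ k * (k * 5) + k * 3
    near₁ : ∀ {u} → u ∉ U → Adj G v u → key (info u) ≤ key (info v) → inj₁ u ∈ₗ forbidden (info v)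
    near₂ : ∀ {x u} → Adj G v x → x ∈ U ⊎ key (info v) ≤ key (info x) → Adj G x u → u ∉ U →
      key (info u) ≤ key (info v) → inj₁ u ∈ₗ forbidden (info v)
    parents : ∀ {w} → w ∉ U → Adj G v w → key (info w) ≤ key (info v) → parent (info w) ∈ₗ forbidden (info v)

record State {n} (G : Graph n) (k : ℕ) (U : Subset n) : Set where
  field
    N : ℕ
    info : Fin n → Info n
    bags : List (Bag n)
    bagOK : All (BagOK G k U info) bags
    linked : AllPairs (Linked G U) bags
    placed : ∀ {v} → v ∉ U → Any (λ B → v ∈ mem B) bags
    early : ∀ {v} → v ∉ U → key (info v) < N
    processed : ∀ {v} → v ∉ U → Processed G k U info v

-- Removing one further bag: the component and the bags touching it.

module _ {n : ℕ} (G : Graph n) (k : ℕ) (1≤k : 1 ≤ k) (noMinor : ¬ HasKMinor G (2 + k))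
         {U : Subset n} (S : State G k U) {r : Fin n} (r∈U : r ∈ U) where

  open State S
  open Layers (bfs G U r r∈U) using (C; p; C⊆U; r∈C; d-root; root-unique; closed; constant-outside)
    renaming (d to depth; parent to descend; lipschitz to depth-lipschitz)

  C-closed : ∀ {x y} → x ∈ C → y ∈ U → Adj G x y → y ∈ C
  C-closed x∈C = closed x∈C tt

  C-walk : ∀ {x y} → x ∈ C → WalkIn G (_∈ U) x y → y ∈ C
  C-walk x∈C (here _) = x∈C
  C-walk x∈C (step _ e w) = C-walk (C-closed x∈C (walk-start w) e) w

  walkToRoot : ∀ (A : Subset n) → A ⊆ C → (∀ {v j} → v ∈ A → depth v ≡ suc j → p v ∈ A) →
    ∀ j {v} → v ∈ A → depth v ≡ j → WalkIn G (_∈ A) v r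
  walkToRoot A A⊆C up zero v∈A eq = subst (WalkIn G (_∈ A) _) (root-unique (A⊆C v∈A) eq) (here v∈A)
  walkToRoot A A⊆C up (suc j) v∈A eq =
    let _ , e , eq′ = descend (A⊆C v∈A) eq
    in step v∈A (Adj-sym G e) (walkToRoot A A⊆C up j (up v∈A eq) eq′)

  -- Every vertex climbs to `r` without leaving `A`.
  upClosed⇒connected : ∀ (A : Subset n) → A ⊆ C → (∀ {v j} → v ∈ A → depth v ≡ suc j → p v ∈ A) → Connected G A
  upClosed⇒connected A A⊆C up u v u∈ v∈ =
    walk-++ (walkToRoot A A⊆C up _ u∈ refl) (walk-reverse (walkToRoot A A⊆C up _ v∈ refl))

  C-connected : Connected G C
  C-connected = upClosed⇒connected C (λ v∈ → v∈) (λ v∈ eq → proj₁ (descend v∈ eq))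

  Touches : Bag n → Set
  Touches B = Joined G (mem B) C

  touches? : Decidable Touches
  touches? B = any? λ a → any? λ x → (a ∈? mem B) ×-dec (x ∈? C) ×-dec adj? G a x

  touching : List (Bag n)
  touching = filter touches? bags

  contact : Bag n → Fin n
  contact B with touches? B
  ... | yes (_ , x , _) = x
  ... | no _ = r

  contact∈C : ∀ B → contact B ∈ C
  contact∈C B with touches? B
  ... | yes (_ , _ , _ , x∈C , _) = x∈C
  ... | no _ = r∈C

  contact-adj : ∀ {B} → Touches B → ∃ λ a → a ∈ mem B × Adj G a (contact B)
  contact-adj {B} t with touches? B
  ... | yes (a , _ , a∈ , _ , e) = a , a∈ , e
  ... | no ¬t = contradiction t ¬t

  touching-ok : ∀ {B} → B ∈ₗ touching → BagOK G k U info B × Touches B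
  touching-ok B∈ = let B∈bags , t = ∈-filter⁻ touches? {xs = bags} B∈ in All.lookup bagOK B∈bags , t

  -- Otherwise `k + 1` touching bags and `C` are the branch sets of a clique minor of order `2 + k`.
  fewTouching : length touching ≤ k
  fewTouching = ≮⇒≥ λ k<len → noMinor (model k<len)
    where
    model : k < length touching → HasKMinor G (2 + k)
    model k<len = disjointModel G branch nonempty connected disjoint joined
      where
      at : Fin (suc k) → Fin (length touching)
      at i = inject≤ i k<len
      bag : Fin (suc k) → Bag n
      bag i = lookup touching (at i)
      ok : ∀ i → BagOK G k U info (bag i)
      ok i = proj₁ (touching-ok (∈-lookup (at i)))
      branch : Fin (2 + k) → Subset n
      branch zero = C
      branch (suc i) = mem (bag i)
      nonempty : ∀ i → ∃ (_∈ branch i)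
      nonempty zero = r , r∈C
      nonempty (suc i) = BagOK.nonempty (ok i)
      connected : ∀ i → Connected G (branch i)
      connected zero = C-connected
      connected (suc i) = BagOK.connected (ok i)
      pairs : AllPairs (Linked G U) touching
      pairs = AllPairs.filter⁺ touches? linked
      disjoint : ∀ {i j v} → v ∈ branch i → v ∈ branch j → i ≡ j
      disjoint {zero} {zero} _ _ = refl
      disjoint {zero} {suc j} v∈C v∈B = contradiction (C⊆U v∈C) (BagOK.outside (ok j) v∈B)
      disjoint {suc i} {zero} v∈B v∈C = contradiction (C⊆U v∈C) (BagOK.outside (ok i) v∈B)
      disjoint {suc i} {suc j} v∈A v∈B with <-cmpᶠ (at i) (at j)
      ... | tri< i<j _ _ = contradiction v∈B (proj₁ (lookupPair pairs i<j) v∈A)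
      ... | tri≈ _ i≡j _ = cong suc (inject≤-injective k<len k<len i j i≡j)
      ... | tri> _ _ j<i = contradiction v∈A (proj₁ (lookupPair pairs j<i) v∈B)
      join : ∀ {i j} → at i <ᶠ at j → Joined G (mem (bag i)) (mem (bag j))
      join {i} {j} i<j =
        let a , x , a∈ , x∈ , ax = proj₂ (touching-ok (∈-lookup (at i)))
            b , y , b∈ , y∈ , by = proj₂ (touching-ok (∈-lookup (at j)))
        -- `C` is connected and lies in `U`, so it supplies the walk that `Linked` asks for.
        in proj₂ (lookupPair pairs i<j) a∈ b∈ ax by (walk-map C⊆U (C-connected x y x∈ y∈))
      flip : ∀ {A B} → Joined G A B → Joined G B A
      flip (a , b , a∈ , b∈ , e) = b , a , b∈ , a∈ , Adj-sym G e
      joined : ∀ i j → i ≢ j → Joined G (branch i) (branch j)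
      joined zero zero i≢j = contradiction refl i≢j
      joined zero (suc j) _ = flip (proj₂ (touching-ok (∈-lookup (at j))))
      joined (suc i) zero _ = proj₂ (touching-ok (∈-lookup (at i)))
      joined (suc i) (suc j) i≢j with <-cmpᶠ (at i) (at j)
      ... | tri< i<j _ _ = join i<j
      ... | tri≈ _ i≡j _ = contradiction (cong suc (inject≤-injective k<len k<len i j i≡j)) i≢j
      ... | tri> _ _ j<i = flip (join j<i)

  -- The next bag as a union of root paths.

  orRoot : List (Fin n) → List (Fin n)
  orRoot [] = r ∷ []
  orRoot (x ∷ xs) = x ∷ xs

  orRoot-nonempty : ∀ xs → ∃ (_∈ₗ orRoot xs)
  orRoot-nonempty [] = r , here refl
  orRoot-nonempty (x ∷ xs) = x , here refl

  orRoot⁺ : ∀ {x xs} → x ∈ₗ xs → x ∈ₗ orRoot xs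
  orRoot⁺ {xs = _ ∷ _} x∈ = x∈

  orRoot-length : ∀ xs → length xs ≤ k → length (orRoot xs) ≤ k
  orRoot-length [] _ = 1≤k
  orRoot-length (_ ∷ _) ≤k = ≤k

  orRoot⊆C : ∀ xs → (∀ {x} → x ∈ₗ xs → x ∈ C) → ∀ {x} → x ∈ₗ orRoot xs → x ∈ C
  orRoot⊆C [] _ (here refl) = r∈C
  orRoot⊆C (_ ∷ _) xs⊆C x∈ = xs⊆C x∈

  -- When no bag touches `C`, the single target `r` keeps the bag nonempty; `1 ≤ k` leaves room for
  -- its path.
  targets : List (Fin n)
  targets = orRoot (map contact touching)

  targets⊆C : ∀ {c} → c ∈ₗ targets → c ∈ C
  targets⊆C = orRoot⊆C (map contact touching) λ x∈ →
    let B , _ , eq = ∈-map⁻ contact x∈ in subst (_∈ C) (≡-sym eq) (contact∈C B)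

  -- A decidable form of being an ancestor of `c` in the BFS tree.
  OnPath : Fin n → Fin n → Set
  OnPath v c = depth v ≤ depth c × iterate p (depth c ∸ depth v) c ≡ v

  onPath? : ∀ v → Decidable (OnPath v)
  onPath? v c = (depth v ≤? depth c) ×-dec (iterate p (depth c ∸ depth v) c ≟ᶠ v)

  inH? : Decidable (λ v → v ∈ C × Any (OnPath v) targets)
  inH? v = (v ∈? C) ×-dec Any.any? (onPath? v) targets

  H : Subset n
  H = comprehension inH?

  H⁻ : ∀ {v} → v ∈ H → v ∈ C × ∃ λ c → c ∈ₗ targets × OnPath v c
  H⁻ v∈H = let v∈C , any = ∈-comprehension⁻ inH? v∈H in v∈C , find any

  H⊆C : H ⊆ C
  H⊆C = proj₁ ∘ H⁻

  H⊆U : H ⊆ U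
  H⊆U = C⊆U ∘ H⊆C

  targets⊆H : ∀ {c} → c ∈ₗ targets → c ∈ H
  targets⊆H {c} c∈ = ∈-comprehension⁺ inH?
    (targets⊆C c∈ , lose c∈ (≤-refl , cong (λ m → iterate p m c) (n∸n≡0 (depth c))))

  parent-step : ∀ {v c j} → OnPath v c → depth v ≡ suc j → iterate p (depth c ∸ j) c ≡ p v
  parent-step {v} {c} {j} (v≤c , eq) dv rewrite dv =
    trans (cong (λ m → iterate p m c) (∸-unfold v≤c)) (cong p eq)

  H-up : ∀ {v j} → v ∈ H → depth v ≡ suc j → p v ∈ H
  H-up {v} {j} v∈H dv =
    let v∈C , c , c∈ , on = H⁻ v∈H
        pv∈C , _ , dpv = descend v∈C dv
    in ∈-comprehension⁺ inH? (pv∈C , lose c∈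
         ( ≤-trans (≤-reflexive dpv) (≤-trans (n≤1+n j) (≤-trans (≤-reflexive (≡-sym dv)) (proj₁ on)))
         , trans (cong (λ m → iterate p (depth c ∸ m) c) dpv) (parent-step on dv)))

  H-connected : Connected G H
  H-connected = upClosed⇒connected H H⊆C H-up

  r∈H : r ∈ H
  r∈H = let c , c∈ = orRoot-nonempty (map contact touching)
        in walk-start (walk-reverse (walkToRoot H H⊆C H-up _ (targets⊆H c∈) refl))

  -- Past the depth of `c`, truncated subtraction repeats `c`, so windows may run over the end of a
  -- path.
  pathTrack : Fin n → Track n
  pathTrack c zero = inj₂ r
  pathTrack c (suc j) = inj₁ (iterate p (depth c ∸ j) c)

  parentRef : ℕ → Fin n → Ref n
  parentRef zero v = inj₂ v
  parentRef (suc _) v = inj₁ (p v)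

  newBag : Bag n
  newBag = record { mem = H ; d = depth ; tracks = map pathTrack targets }

  newInfo : Fin n → Info n
  newInfo v = record
    -- `N` exceeds all earlier keys, so the new bag follows every earlier one.
    { key = N + depth v
    ; parent = parentRef (depth v) v
    -- Three levels suffice in the own bag, since its deeper vertices come later.
    ; forbidden = concatMap (λ B → concatMap (window 5 (d B v)) (tracks B)) touching
               ++ concatMap (window 3 (depth v)) (tracks newBag) }

  info′ : Fin n → Info n
  info′ = override H newInfo info

  info-new : ∀ {v} → v ∈ H → info′ v ≡ newInfo v
  info-new = override-∈ newInfo info

  info-old : ∀ {v} → v ∉ U → info′ v ≡ info v
  info-old v∉U = override-∉ newInfo info (v∉U ∘ H⊆U)

  newFew : length (tracks newBag) ≤ k
  newFew = ≤-trans (≤-reflexive (length-map pathTrack targets))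
    (orRoot-length (map contact touching) (≤-trans (≤-reflexive (length-map contact touching)) fewTouching))

  newShort : ∀ v → length (forbidden (newInfo v)) ≤ k * (k * 5) + k * 3
  newShort v = ≤-trans (≤-reflexive (length-++ old)) (+-mono-≤
    (≤-trans (length-concatMap-≤ perBag touching λ {B} B∈ → windows 5 (d B v) (tracks B) (BagOK.few (proj₁ (touching-ok B∈))))
      (*-monoˡ-≤ (k * 5) fewTouching))
    (windows 3 (depth v) (tracks newBag) newFew))
    where
    perBag : Bag n → List (Ref n)
    perBag B = concatMap (window 5 (d B v)) (tracks B)
    old = concatMap perBag touching
    windows : ∀ m D (es : List (Track n)) → length es ≤ k → length (concatMap (window m D) es) ≤ k * m
    windows m D es ≤k = ≤-trans
      (length-concatMap-≤ (window m D) es λ _ → ≤-reflexive (length-applyUpTo _ m)) (*-monoˡ-≤ m ≤k)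

  newCovered : ∀ {u} → u ∈ H → ∃ λ e → e ∈ₗ tracks newBag × e (suc (depth u)) ≡ inj₁ u × e (depth u) ≡ parent (newInfo u)
  newCovered {u} u∈H =
    let u∈C , c , c∈ , on = H⁻ u∈H
    in pathTrack c , ∈-map⁺ pathTrack c∈ , cong inj₁ (proj₂ on) , atParent u∈C on (depth u) refl
    where
    atParent : ∀ {c} → u ∈ C → OnPath u c → ∀ j → depth u ≡ j → pathTrack c j ≡ parentRef j u
    atParent u∈C on zero eq = cong inj₂ (≡-sym (root-unique u∈C eq))
    atParent u∈C on (suc j) eq = cong inj₁ (parent-step on eq)

  ∈-bagWindows : ∀ {v B e j} → B ∈ₗ touching → e ∈ₗ tracks B → d B v ≤ suc j → suc (suc j) ≤ 5 + d B v →
    e j ∈ₗ forbidden (newInfo v)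
  ∈-bagWindows {v} {B} {e} B∈ e∈ lower upper = ∈-++⁺ˡ
    (∈-concatMap⁺ (λ B → concatMap (window 5 (d B v)) (tracks B)) (lose B∈
      (∈-concatMap⁺ (window 5 (d B v)) (lose e∈ (∈-window 5 e lower upper)))))

  ∈-ownWindows : ∀ {v e j} → e ∈ₗ tracks newBag → depth v ≤ suc j → suc (suc j) ≤ 3 + depth v →
    e j ∈ₗ forbidden (newInfo v)
  ∈-ownWindows {v} {e} e∈ lower upper = ∈-++⁺ʳ (concatMap (λ B → concatMap (window 5 (d B v)) (tracks B)) touching)
    (∈-concatMap⁺ (window 3 (depth v)) (lose e∈ (∈-window 3 e lower upper)))

  -- The remaining vertices and the invariant on bags.

  remaining? : Decidable (λ v → v ∈ U × v ∉ H)
  remaining? v = (v ∈? U) ×-dec ¬? (v ∈? H)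

  U′ : Subset n
  U′ = comprehension remaining?

  U′⁻ : ∀ {v} → v ∈ U′ → v ∈ U × v ∉ H
  U′⁻ = ∈-comprehension⁻ remaining?

  U′⊆U : U′ ⊆ U
  U′⊆U = proj₁ ∘ U′⁻

  U′⊂U : U′ ⊂ U
  U′⊂U = U′⊆U , r , r∈U , λ r∈U′ → proj₂ (U′⁻ r∈U′) r∈H

  done : ∀ {v} → v ∉ U′ → v ∈ H ⊎ v ∉ U
  done {v} v∉U′ with v ∈? H
  ... | yes v∈H = inj₁ v∈H
  ... | no v∉H = inj₂ λ v∈U → v∉U′ (∈-comprehension⁺ remaining? (v∈U , v∉H))

  -- Adjacent vertices of `U` lie both in `C` or both outside it, where `depth` is constant.
  depth-adjacent : ∀ {x y} → x ∈ U → y ∈ U → Adj G x y → depth x ≤ suc (depth y)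
  depth-adjacent {x} {y} x∈U y∈U e with x ∈? C
  ... | yes x∈C = depth-lipschitz (C-closed x∈C y∈U e) x∈C (Adj-sym G e)
  ... | no x∉C = ≤-trans (≤-reflexive (constant-outside x∉C λ y∈C → x∉C (C-closed y∈C x∈U (Adj-sym G e)))) (n≤1+n _)

  newBagOK : BagOK G k U′ info′ newBag
  newBagOK = record
    { nonempty = r , r∈H
    ; connected = H-connected
    ; few = newFew
    ; covered = λ u∈H → let e , e∈ , at , up = newCovered u∈H
                        in e , e∈ , at , trans up (cong parent (≡-sym (info-new u∈H)))
    ; outside = λ u∈H u∈U′ → proj₂ (U′⁻ u∈U′) u∈H
    ; lipschitz = λ x∈ y∈ e → depth-adjacent (U′⊆U x∈) (inU y∈) e , depth-adjacent (inU y∈) (U′⊆U x∈) (Adj-sym G e) }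
    where
    inU : ∀ {y} → y ∈ U′ ⊎ y ∈ H → y ∈ U
    inU (inj₁ y∈) = U′⊆U y∈
    inU (inj₂ y∈) = H⊆U y∈

  oldBagOK : ∀ {B} → BagOK G k U info B → BagOK G k U′ info′ B
  oldBagOK ok = record
    { nonempty = nonempty
    ; connected = connected
    ; few = few
    ; covered = λ u∈ → let e , e∈ , at , up = covered u∈
                       in e , e∈ , at , trans up (cong parent (≡-sym (info-old (outside u∈))))
    ; outside = λ u∈ → outside u∈ ∘ U′⊆U
    ; lipschitz = λ x∈ y∈ → lipschitz (U′⊆U x∈) (Sum.map₁ U′⊆U y∈) }
    where open BagOK ok

  -- A walk through remaining vertices starting next to `H` stays in `C`. Hence `B` touches `C`, and
  -- its contact, being a target, lies in `H`.
  newLinked : ∀ {B} → B ∈ₗ bags → Linked G U′ newBag B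
  newLinked {B} B∈ = (λ v∈H v∈B → BagOK.outside (All.lookup bagOK B∈) v∈B (H⊆U v∈H)) , join
    where
    join : ∀ {a b x y} → a ∈ H → b ∈ mem B → Adj G a x → Adj G b y → WalkIn G (_∈ U′) x y → Joined G H (mem B)
    join {b = b} {x} {y} a∈H b∈B ax by w =
      let x∈C = C-closed (H⊆C a∈H) (U′⊆U (walk-start w)) ax
          touch = b , y , b∈B , C-walk x∈C (walk-map U′⊆U w) , by
          a′ , a′∈ , e = contact-adj touch
      in contact B , a′ , targets⊆H (orRoot⁺ (∈-map⁺ contact (∈-filter⁺ touches? B∈ touch))) , a′∈ , Adj-sym G e

  oldLinked : ∀ {A B} → Linked G U A B → Linked G U′ A B
  oldLinked (disjoint , join) = disjoint , λ a∈ b∈ ax by w → join a∈ b∈ ax by (walk-map U′⊆U w)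

  -- Forbidden lists of new and old vertices.

  key-new : ∀ {v} → v ∈ H → key (info′ v) ≡ N + depth v
  key-new = cong key ∘ info-new

  key-old : ∀ {v} → v ∉ U → key (info′ v) < N
  key-old v∉U = ≤-trans (≤-reflexive (cong (suc ∘ key) (info-old v∉U))) (early v∉U)

  new≰old : ∀ {u v} → u ∈ H → v ∉ U → ¬ key (info′ u) ≤ key (info′ v)
  new≰old u∈H v∉U u≤v = <⇒≱ (key-old v∉U) (≤-trans (≤-trans (m≤m+n N _) (≤-reflexive (≡-sym (key-new u∈H)))) u≤v)

  depth-≤ : ∀ {u v} → u ∈ H → v ∈ H → key (info′ u) ≤ key (info′ v) → depth u ≤ depth v
  depth-≤ u∈H v∈H u≤v = +-cancelˡ-≤ N _ _ (≤-trans (≤-reflexive (≡-sym (key-new u∈H))) (≤-trans u≤v (≤-reflexive (key-new v∈H))))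

  forbidden-new : ∀ {v x} → v ∈ H → x ∈ₗ forbidden (newInfo v) → x ∈ₗ forbidden (info′ v)
  forbidden-new v∈H = subst (λ i → _ ∈ₗ forbidden i) (≡-sym (info-new v∈H))

  bagOf : ∀ {u} → u ∉ U → ∃ λ B → B ∈ₗ bags × u ∈ mem B
  bagOf = find ∘ placed

  newProcessed : ∀ {v} → v ∈ H → Processed G k U′ info′ v
  newProcessed {v} v∈H = record
    { parentOK = parentOK (depth v) refl
    ; short = ≤-trans (≤-reflexive (cong (length ∘ forbidden) (info-new v∈H))) (newShort v)
    ; near₁ = λ u∉ e u≤v → forbidden-new v∈H (near₁ (done u∉) e u≤v)
    ; near₂ = λ vx late xu u∉ u≤v → forbidden-new v∈H (near₂ vx (inU late) xu (done u∉) u≤v)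
    ; parents = λ w∉ e w≤v → forbidden-new v∈H (parents (done w∉) e w≤v) }
    where
    v∈C = H⊆C v∈H
    v∈U = H⊆U v∈H
    parentOK : ∀ j → depth v ≡ j → parent (info′ v) ≡ inj₂ v ⊎
      ∃ λ p → parent (info′ v) ≡ inj₁ p × Adj G v p × p ∉ U′ × key (info′ p) < key (info′ v)
    parentOK zero eq = inj₁ (trans (cong parent (info-new v∈H)) (cong (λ j → parentRef j v) eq))
    parentOK (suc j) eq =
      let _ , e , eq′ = descend v∈C eq
          pv∈H = H-up v∈H eq
      in inj₂ (p v , trans (cong parent (info-new v∈H)) (cong (λ j → parentRef j v) eq) , Adj-sym G e
              , (λ pv∈U′ → proj₂ (U′⁻ pv∈U′) pv∈H)
              , ≤-trans (≤-reflexive (trans (cong suc (trans (key-new pv∈H) (cong (N +_) eq′))) (≡-sym (+-suc N j))))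
                        (≤-reflexive (trans (cong (N +_) (≡-sym eq)) (≡-sym (key-new v∈H)))))
    -- Vertices placed before precede all of `H`, so a vertex not before `v` lies in `U`.
    inU : ∀ {x} → x ∈ U′ ⊎ key (info′ v) ≤ key (info′ x) → x ∈ U
    inU (inj₁ x∈U′) = U′⊆U x∈U′
    inU {x} (inj₂ v≤x) with x ∈? U
    ... | yes x∈U = x∈U
    ... | no x∉U = contradiction v≤x (new≰old v∈H x∉U)
    own : ∀ {u} → u ∈ H → depth v ≤ 2 + depth u → depth u ≤ depth v → inj₁ u ∈ₗ forbidden (newInfo v)
    own u∈H lower upper =
      let _ , e∈ , at , _ = newCovered u∈H
      in subst (_∈ₗ forbidden (newInfo v)) at (∈-ownWindows e∈ lower (s≤s (s≤s (s≤s upper))))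
    -- A parent reference sits one position before its vertex, so `w` may be only one level above
    -- `v`; a neighbour of `v` is.
    ownParent : ∀ {w} → w ∈ H → depth v ≤ 1 + depth w → depth w ≤ depth v → parent (info′ w) ∈ₗ forbidden (newInfo v)
    ownParent w∈H lower upper =
      let _ , e∈ , _ , up = newCovered w∈H
      in subst (_∈ₗ forbidden (newInfo v)) (trans up (cong parent (≡-sym (info-new w∈H))))
           (∈-ownWindows e∈ lower (s≤s (s≤s (≤-trans upper (n≤1+n _)))))
    older : ∀ {u B} → B ∈ₗ touching → u ∈ mem B → d B v ≤ 2 + d B u → d B u ≤ 2 + d B v → inj₁ u ∈ₗ forbidden (newInfo v)
    older B∈ u∈B lower upper =
      let _ , e∈ , at , _ = BagOK.covered (proj₁ (touching-ok B∈)) u∈B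
      in subst (_∈ₗ forbidden (newInfo v)) at (∈-bagWindows B∈ e∈ lower (s≤s (s≤s (s≤s upper))))
    olderParent : ∀ {w B} → B ∈ₗ touching → w ∈ mem B → d B v ≤ 1 + d B w → d B w ≤ 1 + d B v → parent (info w) ∈ₗ forbidden (newInfo v)
    olderParent B∈ w∈B lower upper =
      let _ , e∈ , _ , up = BagOK.covered (proj₁ (touching-ok B∈)) w∈B
      in subst (_∈ₗ forbidden (newInfo v)) up (∈-bagWindows B∈ e∈ lower (s≤s (s≤s (≤-trans upper (s≤s (m≤n+m _ 2))))))
    touched : ∀ {x u B} → x ∈ C → Adj G x u → B ∈ₗ bags → u ∈ mem B → B ∈ₗ touching
    touched x∈C e B∈ u∈B = ∈-filter⁺ touches? B∈ (_ , _ , u∈B , x∈C , Adj-sym G e)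
    near₁ : ∀ {u} → u ∈ H ⊎ u ∉ U → Adj G v u → key (info′ u) ≤ key (info′ v) → inj₁ u ∈ₗ forbidden (newInfo v)
    near₁ (inj₁ u∈H) e u≤v = own u∈H (≤-trans (depth-adjacent v∈U (H⊆U u∈H) e) (n≤1+n _)) (depth-≤ u∈H v∈H u≤v)
    near₁ (inj₂ u∉U) e _ =
      let B , B∈ , u∈B = bagOf u∉U
          v≤u , u≤v = BagOK.lipschitz (All.lookup bagOK B∈) v∈U (inj₂ u∈B) e
      in older (touched v∈C e B∈ u∈B) u∈B (≤-trans v≤u (n≤1+n _)) (≤-trans u≤v (n≤1+n _))
    near₂ : ∀ {x u} → Adj G v x → x ∈ U → Adj G x u → u ∈ H ⊎ u ∉ U → key (info′ u) ≤ key (info′ v) → inj₁ u ∈ₗ forbidden (newInfo v)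
    near₂ vx x∈U xu (inj₁ u∈H) u≤v =
      own u∈H (≤-trans (depth-adjacent v∈U x∈U vx) (s≤s (depth-adjacent x∈U (H⊆U u∈H) xu))) (depth-≤ u∈H v∈H u≤v)
    near₂ vx x∈U xu (inj₂ u∉U) _ =
      let B , B∈ , u∈B = bagOf u∉U
          lip = BagOK.lipschitz (All.lookup bagOK B∈)
          v≤x , x≤v = lip v∈U (inj₁ x∈U) vx
          x≤u , u≤x = lip x∈U (inj₂ u∈B) xu
      -- `x` lies in `C` along with `v`, so the bag of `u` touches `C`; two Lipschitz steps give two
      -- levels.
      in older (touched (C-closed v∈C x∈U vx) xu B∈ u∈B) u∈B (≤-trans v≤x (s≤s x≤u)) (≤-trans u≤x (s≤s x≤v))
    parents : ∀ {w} → w ∈ H ⊎ w ∉ U → Adj G v w → key (info′ w) ≤ key (info′ v) → parent (info′ w) ∈ₗ forbidden (newInfo v)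
    parents (inj₁ w∈H) e w≤v = ownParent w∈H (depth-adjacent v∈U (H⊆U w∈H) e) (depth-≤ w∈H v∈H w≤v)
    parents (inj₂ w∉U) e _ =
      let B , B∈ , w∈B = bagOf w∉U
          v≤w , w≤v = BagOK.lipschitz (All.lookup bagOK B∈) v∈U (inj₂ w∈B) e
      in subst (_∈ₗ forbidden (newInfo v)) (cong parent (≡-sym (info-old w∉U))) (olderParent (touched v∈C e B∈ w∈B) w∈B v≤w w≤v)

  -- The old list stays sufficient: no vertex of `H` is earlier than `v`, and as intermediate
  -- vertices those of `H` were covered as members of `U`.
  oldProcessed : ∀ {v} → v ∉ U → Processed G k U′ info′ v
  oldProcessed {v} v∉U = record
    { parentOK = parentOK old.parentOK
    ; short = ≤-trans (≤-reflexive (cong (length ∘ forbidden) iv)) old.short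
    ; near₁ = λ u∉ e u≤v → near₁ (done u∉) e u≤v
    ; near₂ = λ vx late xu u∉ u≤v → near₂ vx late xu (done u∉) u≤v
    ; parents = λ w∉ e w≤v → parents (done w∉) e w≤v }
    where
    module old = Processed (processed v∉U)
    iv = info-old v∉U
    parentOK : parent (info v) ≡ inj₂ v ⊎ (∃ λ p → parent (info v) ≡ inj₁ p × Adj G v p × p ∉ U × key (info p) < key (info v)) →
      parent (info′ v) ≡ inj₂ v ⊎ ∃ λ p → parent (info′ v) ≡ inj₁ p × Adj G v p × p ∉ U′ × key (info′ p) < key (info′ v)
    parentOK (inj₁ eq) = inj₁ (trans (cong parent iv) eq)
    parentOK (inj₂ (q , eq , e , q∉U , q<v)) rewrite iv =
      inj₂ (q , eq , e , q∉U ∘ U′⊆U , ≤-trans (≤-reflexive (cong (suc ∘ key) (info-old q∉U))) q<v)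
    near₁ : ∀ {u} → u ∈ H ⊎ u ∉ U → Adj G v u → key (info′ u) ≤ key (info′ v) → inj₁ u ∈ₗ forbidden (info′ v)
    near₁ (inj₁ u∈H) e u≤v = contradiction u≤v (new≰old u∈H v∉U)
    near₁ (inj₂ u∉U) e u≤v rewrite iv | info-old u∉U = old.near₁ u∉U e u≤v
    late′ : ∀ {x} → x ∈ U′ ⊎ key (info′ v) ≤ key (info′ x) → x ∈ U ⊎ key (info v) ≤ key (info x)
    late′ (inj₁ x∈U′) = inj₁ (U′⊆U x∈U′)
    late′ {x} (inj₂ v≤x) with x ∈? U
    ... | yes x∈U = inj₁ x∈U
    ... | no x∉U = inj₂ (≤-trans (≤-reflexive (cong key (≡-sym iv))) (≤-trans v≤x (≤-reflexive (cong key (info-old x∉U)))))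
    near₂ : ∀ {x u} → Adj G v x → x ∈ U′ ⊎ key (info′ v) ≤ key (info′ x) → Adj G x u → u ∈ H ⊎ u ∉ U →
      key (info′ u) ≤ key (info′ v) → inj₁ u ∈ₗ forbidden (info′ v)
    near₂ vx late xu (inj₁ u∈H) u≤v = contradiction u≤v (new≰old u∈H v∉U)
    near₂ vx late xu (inj₂ u∉U) u≤v with late′ late
    ... | late rewrite iv | info-old u∉U = old.near₂ vx late xu u∉U u≤v
    parents : ∀ {w} → w ∈ H ⊎ w ∉ U → Adj G v w → key (info′ w) ≤ key (info′ v) → parent (info′ w) ∈ₗ forbidden (info′ v)
    parents (inj₁ w∈H) e w≤v = contradiction w≤v (new≰old w∈H v∉U)
    parents (inj₂ w∉U) e w≤v rewrite iv | info-old w∉U = old.parents w∉U e w≤v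

  addBag : State G k U′
  addBag = record
    { N = N + proj₁ (bounded depth)
    ; info = info′
    ; bags = newBag ∷ bags
    ; bagOK = newBagOK ∷ All.map oldBagOK bagOK
    ; linked = All.tabulate newLinked ∷ AllPairs.map (λ {A} {B} → oldLinked {A} {B}) linked
    ; placed = λ v∉ → place (done v∉)
    ; early = λ v∉ → keyBound (done v∉)
    ; processed = λ v∉ → process (done v∉) }
    where
    place : ∀ {v} → v ∈ H ⊎ v ∉ U → Any (λ B → v ∈ mem B) (newBag ∷ bags)
    place (inj₁ v∈H) = here v∈H
    place (inj₂ v∉U) = there (placed v∉U)
    keyBound : ∀ {v} → v ∈ H ⊎ v ∉ U → key (info′ v) < N + proj₁ (bounded depth)
    keyBound {v} (inj₁ v∈H) = ≤-trans (≤-reflexive (cong suc (key-new v∈H))) (+-monoʳ-< N (proj₂ (bounded depth) v))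
    keyBound (inj₂ v∉U) = ≤-trans (key-old v∉U) (m≤m+n N _)
    process : ∀ {v} → v ∈ H ⊎ v ∉ U → Processed G k U′ info′ v
    process (inj₁ v∈H) = newProcessed v∈H
    process (inj₂ v∉U) = oldProcessed v∉U

-- Removing bags until no vertex remains.

finished : ∀ {n} (G : Graph n) k → 1 ≤ k → ¬ HasKMinor G (2 + k) → ∃ λ U → Empty U × State G k U
finished {n} G k 1≤k noMinor = run (⊂-wellFounded ⊤) start
  where
  run : ∀ {U} → Acc _⊂_ U → State G k U → ∃ λ U → Empty U × State G k U
  run {U} (acc rec) S with nonempty? U
  ... | yes (r , r∈U) = run (rec (U′⊂U G k 1≤k noMinor S r∈U)) (addBag G k 1≤k noMinor S r∈U)
  ... | no empty = U , empty , S
  start : State G k ⊤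
  start = record
    { N = 0
    -- Placeholder values: no vertex is placed yet.
    ; info = λ v → record { key = 0 ; parent = inj₂ v ; forbidden = [] }
    ; bags = []
    ; bagOK = []
    ; linked = []
    ; placed = λ v∉ → contradiction ∈⊤ v∉
    ; early = λ v∉ → contradiction ∈⊤ v∉
    ; processed = λ v∉ → contradiction ∈⊤ v∉ }

-- A linear order refining the keys.

minimiser : ∀ {n} (rank : Fin n → ℕ) {P : Fin n → Set} → Decidable P → ∃ P →
  ∃ λ x → P x × (∀ {y} → P y → rank x ≤ rank y)
minimiser {n} rank {P} P? (x , px) = descend x px (<-wellFounded (rank x))
  where
  descend : ∀ x → P x → Acc _<_ (rank x) → ∃ λ x → P x × (∀ {y} → P y → rank x ≤ rank y)
  descend x px (acc rec) with any? (λ y → P? y ×-dec (rank y <? rank x))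
  ... | yes (y , py , y<x) = descend y py (rec y<x)
  ... | no none = x , px , λ {y} py → ≮⇒≥ λ y<x → none (y , py , y<x)

module _ {n : ℕ} (key : Fin n → ℕ) where

  -- Lexicographic order by key, then index, in one number, as indices are below `n`.
  lexRank : Fin n → ℕ
  lexRank v = key v * n + toℕ v

  lexRank-mono : ∀ {u v} → key u < key v → lexRank u < lexRank v
  lexRank-mono {u} {v} u<v = begin-strict
    key u * n + toℕ u <⟨ +-monoʳ-< (key u * n) (toℕ<n u) ⟩
    key u * n + n     ≡⟨ +-comm (key u * n) n ⟩
    suc (key u) * n   ≤⟨ *-monoˡ-≤ n u<v ⟩
    key v * n         ≤⟨ m≤m+n _ (toℕ v) ⟩
    lexRank v         ∎
    where open ≤-Reasoning

  lexRank-reflects : ∀ {u v} → lexRank u ≤ lexRank v → key u ≤ key v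
  lexRank-reflects u≤v = ≮⇒≥ λ v<u → <⇒≱ (lexRank-mono v<u) u≤v

  lexRank-injective : ∀ {u v} → lexRank u ≡ lexRank v → u ≡ v
  lexRank-injective {u} {v} eq = toℕ-injective (+-cancelˡ-≡ (key u * n) _ _ (trans eq (cong (λ m → m * n + toℕ v) (≡-sym same))))
    where
    same : key u ≡ key v
    same = ≤-antisym (lexRank-reflects (≤-reflexive eq)) (lexRank-reflects (≤-reflexive (≡-sym eq)))

-- The greedy colouring is proper and conflict-free.

module _ {n : ℕ} (G : Graph n) (k : ℕ) {U : Subset n} (U-empty : Empty U) (S : State G k U) where

  open State S using (info; processed)

  ∉U : ∀ {v} → v ∉ U
  ∉U {v} v∈U = U-empty (v , v∈U)

  module At (v : Fin n) = Processed (processed {v} ∉U)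

  rank : Fin n → ℕ
  rank = lexRank (key ∘ info)

  rank-key : ∀ {u v} → rank u < rank v → key (info u) ≤ key (info v)
  rank-key = lexRank-reflects (key ∘ info) ∘ <⇒≤

  -- The value at an isolated `w` is a dummy; conflict-freeness asks nothing there.
  firstNeighbour : Fin n → Fin n
  firstNeighbour w with any? (adj? G w)
  ... | yes some = proj₁ (minimiser rank (adj? G w) some)
  ... | no _ = w

  firstNeighbour-first : ∀ {w x} → Adj G w x → Adj G w (firstNeighbour w) × rank (firstNeighbour w) ≤ rank x
  firstNeighbour-first {w} {x} e with any? (adj? G w)
  ... | yes some = let _ , e′ , min = minimiser rank (adj? G w) some in e′ , min e
  ... | no none = contradiction (x , e) none

  resolve : Ref n → Fin n
  resolve (inj₁ u) = u
  resolve (inj₂ r) = firstNeighbour r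

  -- The neighbour of w whose colour is to be unique in the neighbourhood of w.
  π : Fin n → Fin n
  π w = resolve (parent (info w))

  F : Fin n → List (Fin n)
  F v = map resolve (forbidden (info v))

  resolve-F : ∀ {v x} → x ∈ₗ forbidden (info v) → resolve x ∈ₗ F v
  resolve-F = ∈-map⁺ resolve

  π-adj : ∀ {w x} → Adj G w x → Adj G w (π w)
  π-adj {w} e with At.parentOK w
  ... | inj₁ eq rewrite eq = proj₁ (firstNeighbour-first e)
  ... | inj₂ (_ , eq , e′ , _) rewrite eq = e′

  module _ {c : ℕ} (ψ : Fin n → Fin c) (good : ∀ u v → u ∈ₗ F v → rank u < rank v → ψ u ≢ ψ v) where

    proper : Proper G ψ
    proper u v e eq with <-cmp (rank u) (rank v)
    ... | tri< u<v _ _ = good u v (resolve-F (At.near₁ v ∉U (Adj-sym G e) (rank-key u<v))) u<v eq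
    ... | tri≈ _ u≡v _ = contradiction (trans (≡-sym e) (trans (cong (λ x → adj G x v) (lexRank-injective (key ∘ info) u≡v)) (irrfl G v))) λ ()
    ... | tri> _ _ v<u = good v u (resolve-F (At.near₁ u ∉U e (rank-key v<u))) v<u (≡-sym eq)

    -- No neighbour of a BFS root precedes its first one. Otherwise `π w` comes before `w`, so `x`
    -- is seen from `π w` through the later `w`.
    noEarlierClash : ∀ {w x} → Adj G w x → rank x < rank (π w) → ψ x ≢ ψ (π w)
    noEarlierClash {w} {x} e x<π with At.parentOK w
    ... | inj₁ eq rewrite eq = contradiction (proj₂ (firstNeighbour-first e)) (<⇒≱ x<π)
    ... | inj₂ (q , eq , e′ , _ , q<w) rewrite eq =
      good x q (resolve-F (At.near₂ q (Adj-sym G e′) (inj₂ (<⇒≤ q<w)) e ∉U (rank-key x<π))) x<π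

    -- If the key of `w` is at most that of `x`, then `x` avoids the parent of `w`; otherwise `π w`
    -- is seen from `x` through the later `w`.
    noLaterClash : ∀ {w x} → Adj G w x → rank (π w) < rank x → ψ (π w) ≢ ψ x
    noLaterClash {w} {x} e π<x with ≤-total (key (info w)) (key (info x))
    ... | inj₁ w≤x = good (π w) x (resolve-F (At.parents x ∉U (Adj-sym G e) w≤x)) π<x
    ... | inj₂ x≤w = good (π w) x (resolve-F (At.near₂ x (Adj-sym G e) (inj₂ x≤w) (π-adj e) ∉U (rank-key π<x))) π<x

    conflictFree : ConflictFree G ψ
    conflictFree w (_ , e) = ψ (π w) , π w , π-adj e , refl , unique
      where
      unique : ∀ x → Adj G w x → ψ x ≡ ψ (π w) → x ≡ π w
      unique x e eq with <-cmp (rank x) (rank (π w))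
      ... | tri< x<π _ _ = contradiction eq (noEarlierClash e x<π)
      ... | tri≈ _ x≡π _ = lexRank-injective (key ∘ info) x≡π
      ... | tri> _ _ π<x = contradiction (≡-sym eq) (noLaterClash e π<x)

-- The number of colours.

colourCount : ∀ k → 1 ≤ k → ∃ λ c → suc c ≡ 5 * (1 + k) * k ∸ 1 × k * (k * 5) + k * 3 < suc c
-- With k = 1 + j, 5k(k + 1) exceeds 5k² + 3k by 2 + 2j: one unit is subtracted in the bound, one
-- makes it strict, and 2j is slack.
colourCount (suc j) _ = _ , cong (_∸ 1) (total j) , s≤s (m≤m+n _ (2 * j))
  where
  total : ∀ j → 2 + ((suc j * (suc j * 5) + suc j * 3) + 2 * j) ≡ 5 * (2 + j) * suc j
  total = solve 1 (λ j → con 2 :+ (((con 1 :+ j) :* ((con 1 :+ j) :* con 5) :+ (con 1 :+ j) :* con 3) :+ con 2 :* j)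
    := con 5 :* (con 2 :+ j) :* (con 1 :+ j)) refl

theorem3 : (t : ℕ) → 3 ≤ t → (n : ℕ) → (G : Graph (suc n)) →
    ¬ HasKMinor G t → χpcf≤ G (5 * (t ∸ 1) * (t ∸ 2) ∸ 1)
theorem3 (suc (suc k)) (s≤s (s≤s 1≤k)) n G noMinor =
  let U , U-empty , S = finished G k 1≤k noMinor
      c , eq , enough = colourCount k 1≤k
      ψ , good = greedyColouring (rank G k U-empty S) (F G k U-empty S) λ v →
        ≤-trans (s≤s (≤-trans (≤-reflexive (length-map _ (forbidden (State.info S v)))) (Processed.short (State.processed S (∉U G k U-empty S))))) enough
  in subst (χpcf≤ G) eq (ψ , proper G k U-empty S ψ good , conflictFree G k U-empty S ψ good)
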